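{- Let $\mathbf{w}$ be a Rote word (an infinite binary word having exactly $2n$ distinct factors of length $n$ for every $n\ge 1$) that avoids $(5/2)^+$-powers. Then exactly one of the following four cases holds: \begin{enumerate} \item The set of length-4 factors of $\mathbf{w}$ is $F$, and for every positive integer $n$, some final segment of $\mathbf{w}$ has the form $g(f^n(\mathbf{u}))$ for some proper $\mathbf{u}\in\Sigma_3^\omega$. \item The set of length-4 factors of $\mathbf{w}$ is $\overline{F}$, and for every positive integer $n$, some final segment of $\mathbf{w}$ has the form $\overline{g(f^n(\mathbf{u}))}$ for some proper $\mathbf{u}\in\Sigma_3^\omega$. \item The set of length-4 factors of $\mathbf{w}$ is $F^R$, and for every positive integer $n$, some final segment of $\mathbf{w}$ has the form $g(h^n(\mathbf{u}))$ for some antiproper $\mathbf{u}\in\Sigma_3^\omega$. \item The set of length-4 factors of $\mathbf{w}$ is $\overline{F^R}$, and for every positive integer $n$, some final segment of $\mathbf{w}$ has the form $\overline{g(h^n(\mathbf{u}))}$ for some antiproper $\mathbf{u}\in\Sigma_3^\omega$. \end{enumerate}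
   Context: $\Sigma_2=\{0,1\}$, $\Sigma_3=\{0,1,2\}$. For a finite word $w$ of length $\ell$ with smallest period $p$, its exponent is $\ell/p$; a $(5/2)^+$-power is a word of exponent $>5/2$; a word avoids $(5/2)^+$-powers if none of its factors is a $(5/2)^+$-power. Let $F=\{0110,1001,0011,1100,0010,0100,1101,1010\}$. For a binary word $w$, $\overline{w}$ is its complement (exchange $0$ and $1$) and $w^R$ its reversal; these are extended to sets of words elementwise, and complement is applied letterwise to infinite words. Morphisms: $g:\Sigma_3^*\to\Sigma_2^*$ with $g(0)=011,\ g(1)=0,\ g(2)=01$; $f:\Sigma_3^*\to\Sigma_3^*$ with $f(0)=0121,\ f(1)=021,\ f(2)=01$; $h:\Sigma_3^*\to\Sigma_3^*$ with $h(0)=1210,\ h(1)=120,\ h(2)=10$; all extended to infinite words. Parikh vector $\pi(u)=[|u|_0,|u|_1,|u|_2]$; $\pi(x)>\pi(y)$ means $|x|_i\ge|y|_i$ for all $i$ with strict inequality for some $i$. A finite $u\in\Sigma_3^*$ is proper if it has no factor $xyxyx$ with $\pi(x)>\pi(y)$ and none of $00,11,22,20,10101,2121,10210210$ is a factor of $u$; an infinite word over $\Sigma_3$ is proper if all its finite factors are proper. A finite word is antiproper if its reversal is proper; an infinite word is antiproper if all its finite factors are antiproper. A final segment of an infinite word is a suffix of it. -}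

module Defs where

open import Data.Nat using (ℕ; zero; suc; _+_; _*_; _≤_; _<_)
open import Data.Fin using (Fin; #_; zero; suc)
open import Data.List using (List; []; _∷_; _++_; map; length; upTo; concatMap; reverse; filterᵇ)
open import Data.List.Membership.Propositional using (_∈_)
open import Data.List.Relation.Unary.Unique.Propositional using (Unique)
open import Data.Product using (Σ; ∃; ∃-syntax; _×_; _,_)
open import Data.Sum using (_⊎_)
open import Data.Empty using (⊥)
open import Relation.Binary.PropositionalEquality using (_≡_)
open import Relation.Nullary using (¬_)
open import Function.Bundles using (_⇔_)
open import Data.Fin.Properties using (_≟_)
open import Relation.Nullary.Decidable using (⌊_⌋)

Σ₂ : Set
Σ₂ = Fin 2

Σ₃ : Set
Σ₃ = Fin 3

Inf : Set → Set
Inf A = ℕ → A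

Word : Set → Set
Word A = List A

factorAt : {A : Set} → Inf A → ℕ → ℕ → Word A
factorAt w i n = map (λ k → w (i + k)) (upTo n)

prefix : {A : Set} → Inf A → ℕ → Word A
prefix w n = factorAt w 0 n

IsFactor : {A : Set} → Inf A → Word A → Set
IsFactor w x = ∃[ i ] factorAt w i (length x) ≡ x

IsFactorW : {A : Set} → Word A → Word A → Set
IsFactorW u x = ∃[ p ] ∃[ s ] u ≡ p ++ x ++ s

Rote : Inf Σ₂ → Set
Rote w = ∀ n → 1 ≤ n →
  ∃[ L ] (Unique L × length L ≡ 2 * n ×
          (∀ (x : Word Σ₂) → (x ∈ L ⇔ (IsFactor w x × length x ≡ n))))

nth : {A : Set} → Word A → ℕ → A → Set
nth []       _       a = ⊥
nth (b ∷ _)  zero    a = b ≡ a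
nth (_ ∷ bs) (suc i) a = nth bs i a

IsPeriod : {A : Set} → Word A → ℕ → Set
IsPeriod {A} x p = 1 ≤ p × p ≤ length x ×
  (∀ i (a : A) → i + p < length x → nth x i a → nth x (i + p) a)

IsSmallestPeriod : {A : Set} → Word A → ℕ → Set
IsSmallestPeriod x p = IsPeriod x p × (∀ q → IsPeriod x q → p ≤ q)

-- x is a (5/2)^+-power: exponent |x|/p > 5/2, p the smallest period
-- (the smallest period only exists for nonempty x)
Is52PlusPower : {A : Set} → Word A → Set
Is52PlusPower x = ∃[ p ] (IsSmallestPeriod x p × 5 * p < 2 * length x)

Avoids52Plus : {A : Set} → Inf A → Set
Avoids52Plus w = ∀ x → IsFactor w x → ¬ Is52PlusPower x

morph : {A B : Set} → (A → Word B) → Word A → Word B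
morph φ u = concatMap φ u

lookupD : {B : Set} → B → Word B → ℕ → B
lookupD d []       _       = d
lookupD d (b ∷ _)  zero    = b
lookupD d (_ ∷ bs) (suc k) = lookupD d bs k

-- image of an infinite word under a NON-ERASING morphism φ:
-- the k-th letter of φ(u) is the k-th letter of φ(u[0..k]) (which has
-- length ≥ k+1 as φ is non-erasing, so the default is never used).
morphInf : {A : Set} {m : ℕ} → (A → Word (Fin (suc m))) → Inf A → Inf (Fin (suc m))
morphInf φ u k = lookupD zero (morph φ (prefix u (suc k))) k

iter : {A : Set} → ℕ → (A → A) → A → A
iter zero    F a = a
iter (suc n) F a = F (iter n F a)

g : Σ₃ → Word Σ₂
g zero             = # 0 ∷ # 1 ∷ # 1 ∷ []
g (suc zero)       = # 0 ∷ []
g (suc (suc zero)) = # 0 ∷ # 1 ∷ []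

f : Σ₃ → Word Σ₃
f zero             = # 0 ∷ # 1 ∷ # 2 ∷ # 1 ∷ []
f (suc zero)       = # 0 ∷ # 2 ∷ # 1 ∷ []
f (suc (suc zero)) = # 0 ∷ # 1 ∷ []

h : Σ₃ → Word Σ₃
h zero             = # 1 ∷ # 2 ∷ # 1 ∷ # 0 ∷ []
h (suc zero)       = # 1 ∷ # 2 ∷ # 0 ∷ []
h (suc (suc zero)) = # 1 ∷ # 0 ∷ []

comp : Σ₂ → Σ₂
comp zero = # 1
comp (suc _) = # 0

compW : Word Σ₂ → Word Σ₂
compW = map comp

compInf : Inf Σ₂ → Inf Σ₂
compInf w i = comp (w i)

w4 : Σ₂ → Σ₂ → Σ₂ → Σ₂ → Word Σ₂
w4 a b c d = a ∷ b ∷ c ∷ d ∷ []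

O I : Σ₂
O = # 0
I = # 1

Fset : List (Word Σ₂)
Fset = w4 O I I O ∷ w4 I O O I ∷ w4 O O I I ∷ w4 I I O O ∷
       w4 O O I O ∷ w4 O I O O ∷ w4 I I O I ∷ w4 I O I O ∷ []

compSet : List (Word Σ₂) → List (Word Σ₂)
compSet = map compW

revSet : List (Word Σ₂) → List (Word Σ₂)
revSet = map reverse

Factors4Are : Inf Σ₂ → List (Word Σ₂) → Set
Factors4Are w S = ∀ (x : Word Σ₂) → length x ≡ 4 → (IsFactor w x ⇔ x ∈ S)

count : Σ₃ → Word Σ₃ → ℕ
count a u = length (filterᵇ (λ b → ⌊ a ≟ b ⌋) u)

ParikhGt : Word Σ₃ → Word Σ₃ → Set
ParikhGt x y = (∀ a → count a y ≤ count a x) × (∃[ a ] count a y < count a x)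

forbidden : List (Word Σ₃)
forbidden =
  (# 0 ∷ # 0 ∷ []) ∷ (# 1 ∷ # 1 ∷ []) ∷ (# 2 ∷ # 2 ∷ []) ∷ (# 2 ∷ # 0 ∷ []) ∷
  (# 1 ∷ # 0 ∷ # 1 ∷ # 0 ∷ # 1 ∷ []) ∷ (# 2 ∷ # 1 ∷ # 2 ∷ # 1 ∷ []) ∷
  (# 1 ∷ # 0 ∷ # 2 ∷ # 1 ∷ # 0 ∷ # 2 ∷ # 1 ∷ # 0 ∷ []) ∷ []

ProperW : Word Σ₃ → Set
ProperW u =
  (∀ x y → IsFactorW u (x ++ y ++ x ++ y ++ x) → ¬ ParikhGt x y) ×
  (∀ v → v ∈ forbidden → ¬ IsFactorW u v)

AntiproperW : Word Σ₃ → Set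
AntiproperW u = ProperW (reverse u)

Proper : Inf Σ₃ → Set
Proper u = ∀ x → IsFactor u x → ProperW x

Antiproper : Inf Σ₃ → Set
Antiproper u = ∀ x → IsFactor u x → AntiproperW x

HasFinalSegment : {A : Set} → Inf A → Inf A → Set
HasFinalSegment w v = ∃[ k ] (∀ i → w (k + i) ≡ v i)

Case1 Case2 Case3 Case4 : Inf Σ₂ → Set
Case1 w = Factors4Are w Fset ×
  (∀ n → 1 ≤ n → ∃[ u ] (Proper u × HasFinalSegment w (morphInf g (iter n (morphInf f) u))))
Case2 w = Factors4Are w (compSet Fset) ×
  (∀ n → 1 ≤ n → ∃[ u ] (Proper u × HasFinalSegment w (compInf (morphInf g (iter n (morphInf f) u)))))
Case3 w = Factors4Are w (revSet Fset) ×
  (∀ n → 1 ≤ n → ∃[ u ] (Antiproper u × HasFinalSegment w (morphInf g (iter n (morphInf h) u))))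
Case4 w = Factors4Are w (compSet (revSet Fset)) ×
  (∀ n → 1 ≤ n → ∃[ u ] (Antiproper u × HasFinalSegment w (compInf (morphInf g (iter n (morphInf h) u)))))

ExactlyOne4 : Set → Set → Set → Set → Set
ExactlyOne4 P Q R S =
  (P ⊎ Q ⊎ R ⊎ S) ×
  ¬ (P × Q) × ¬ (P × R) × ¬ (P × S) × ¬ (Q × R) × ¬ (Q × S) × ¬ (R × S)

{-# OPTIONS --safe #-}

-- A backtracking search over prefixes, pruned by (5/2)⁺-powers and by the
-- bounds p(4) ≤ 8 and p(8) ≤ 16 on the factor complexity, is finite and always
-- exhibits one of the four sets of 8 factors of length 4. As p(4) = 8 nothing
-- else occurs, and the cases 2 and 4 reduce to 1 and 3 by complementation.
--
-- When the length-4 factors are those of F, w can be cut at every 0 into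
-- g-blocks. If a tail of w is g(fⁿ(u)), then u is proper after the loss of two
-- letters: xyxyx with π(x) > π(y) has an image of exponent > 5/2, while fⁿ of a
-- forbidden word contains such an xyxyx once n ≥ 2, by means of the common
-- prefixes and suffixes of the words f²(a). A proper word, cut at every 0, is an
-- f-image, which gives the next level. For F^R the same statement about finite
-- words is applied to reversals: (g(hⁿ(x))0)^R = g(fⁿ(x^R))0.
module Submission where

open import Defs

open import Data.Bool using
  (Bool; true; false; _∧_; _∨_; not; if_then_else_; T) renaming (_≟_ to _≟ᵇ_)
open import Data.Fin using (Fin; zero; suc)
open import Data.Fin.Patterns using (0F; 1F; 2F)
open import Data.Fin.Properties using (_≟_) renaming (all? to allFin?; any? to anyFin?)
open import Data.List using (List; []; _∷_; _++_; [_]; map; length; take; drop; reverse; applyUpTo)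
open import Data.List.Membership.Propositional using (_∈_; _∉_)
open import Data.List.Membership.Propositional.Properties using
  (∈-∃++; ∈-++⁻; ∈-++⁺ˡ; ∈-++⁺ʳ; ∈-map⁺; ∈-map⁻)
open import Data.List.Properties using
  (≡-dec; ++-assoc; ++-identityʳ; length-++; length-map; length-reverse; length-take;
   length-applyUpTo; map-++; map-upTo; concatMap-++; reverse-++; reverse-involutive;
   reverse-injective; unfold-reverse; take++drop≡id)
open import Data.List.Relation.Unary.All as All using (All; []; _∷_)
import Data.List.Relation.Unary.All.Properties as AllP
open import Data.List.Relation.Unary.AllPairs using ([]; _∷_)
open import Data.List.Relation.Unary.Any as Any using (Any; here; there)
import Data.List.Relation.Unary.Any.Properties as AnyP
open import Data.List.Relation.Unary.Unique.Propositional using (Unique)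
import Data.List.Relation.Unary.Unique.Propositional.Properties as UniqueP
open import Data.Nat using
  (ℕ; zero; suc; _+_; _*_; _∸_; _≤_; _<_; z≤n; s≤s; _<ᵇ_; _≡ᵇ_; _≤ᵇ_; _≤?_; _<?_)
  renaming (_≟_ to _≟ℕ_)
open import Data.Nat.Induction using (<-wellFounded)
open import Data.Nat.Properties using
  (+-comm; +-assoc; +-suc; +-identityʳ; +-mono-≤; +-mono-<-≤; +-mono-≤-<; +-monoʳ-<;
   +-cancelˡ-<; *-monoʳ-≤; ≤-reflexive; ≤-trans; ≤-total; <⇒≤; <⇒≱; ≤-<-trans; ≰⇒>; m≤m+n;
   m≤n+m; m≤n⇒m⊓n≡m; m+[n∸m]≡n; suc-injective; <ᵇ⇒<; ≤ᵇ⇒≤; ≡ᵇ⇒≡)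
open import Data.Nat.Solver using (module +-*-Solver)
open import Data.Product using (∃-syntax; ∃₂; _×_; _,_; proj₁; proj₂)
open import Data.Sum using (_⊎_; inj₁; inj₂)
open import Data.Empty using (⊥; ⊥-elim)
open import Data.Unit using (⊤; tt)
open import Function using (_∘_)
open import Function.Bundles using (mk⇔; module Equivalence)
open import Induction.WellFounded using (Acc; acc)
open import Relation.Binary.PropositionalEquality using
  (_≡_; refl; sym; trans; cong; cong₂; subst; subst₂; module ≡-Reasoning)
open import Relation.Nullary using (¬_; Dec; yes; no; does)
open import Relation.Nullary.Decidable using
  (True; False; toWitness; toWitnessFalse; from-yes; _×-dec_)

open import Data.List.Membership.DecPropositional (≡-dec (_≟_ {2})) using (_∈?_)
open import Data.List.Relation.Unary.Unique.DecPropositional (≡-dec (_≟_ {2})) using (unique?)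

-- Occurrences of finite words

-- Unlike `factorAt`, this recursive form unfolds along the word, so occurrences split and join
-- along `_++_` without any lookup of indices.
Occ : {A : Set} → Inf A → ℕ → Word A → Set
Occ v i []      = ⊤
Occ v i (a ∷ x) = v i ≡ a × Occ v (suc i) x

occ-++⁺ : ∀ {A : Set} (v : Inf A) i x {y} → Occ v i x → Occ v (length x + i) y → Occ v i (x ++ y)
occ-++⁺ v i []      _       oy = oy
occ-++⁺ v i (a ∷ x) {y} (e , ox) oy =
  e , occ-++⁺ v (suc i) x ox (subst (λ k → Occ v k y) (sym (+-suc (length x) i)) oy)

occ-++⁻ˡ : ∀ {A : Set} (v : Inf A) i x {y} → Occ v i (x ++ y) → Occ v i x
occ-++⁻ˡ v i []      _       = tt
occ-++⁻ˡ v i (a ∷ x) (e , o) = e , occ-++⁻ˡ v (suc i) x o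

occ-++⁻ʳ : ∀ {A : Set} (v : Inf A) i x {y} → Occ v i (x ++ y) → Occ v (length x + i) y
occ-++⁻ʳ v i []      o           = o
occ-++⁻ʳ v i (a ∷ x) {y} (_ , o) =
  subst (λ k → Occ v k y) (+-suc (length x) i) (occ-++⁻ʳ v (suc i) x o)

occ-infix : ∀ {A : Set} (v : Inf A) i p x {s} → Occ v i (p ++ x ++ s) → Occ v (length p + i) x
occ-infix v i p x o = occ-++⁻ˡ v _ x (occ-++⁻ʳ v i p o)

occ-unique : ∀ {A : Set} (v : Inf A) i x y → length x ≡ length y → Occ v i x → Occ v i y → x ≡ y
occ-unique v i []      []      _ _        _        = refl
occ-unique v i (a ∷ x) (b ∷ y) l (e , o) (e′ , o′) =
  cong₂ _∷_ (trans (sym e) e′) (occ-unique v (suc i) x y (suc-injective l) o o′)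

occ-final : ∀ {A : Set} (u v : Inf A) k → (∀ i → u (k + i) ≡ v i) → ∀ j x → Occ v j x → Occ u (k + j) x
occ-final u v k eq j []      _       = tt
occ-final u v k eq j (a ∷ x) (e , o) =
  trans (eq j) e , subst (λ i → Occ u i x) (+-suc k j) (occ-final u v k eq (suc j) x o)

occ-applyUpTo : ∀ {A : Set} (v : Inf A) i (t : ℕ → A) → (∀ k → v (k + i) ≡ t k) → ∀ n → Occ v i (applyUpTo t n)
occ-applyUpTo v i t eq zero    = tt
occ-applyUpTo v i t eq (suc n) =
  eq 0 , occ-applyUpTo v (suc i) (t ∘ suc) (λ k → trans (cong v (+-suc k i)) (eq (suc k))) n

occ-factorAt : ∀ {A : Set} (v : Inf A) i n → Occ v i (factorAt v i n)
occ-factorAt v i n = subst (Occ v i) (sym (map-upTo _ n)) (occ-applyUpTo v i _ (λ k → cong v (+-comm k i)) n)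

length-factorAt : ∀ {A : Set} (v : Inf A) i n → length (factorAt v i n) ≡ n
length-factorAt v i n = trans (cong length (map-upTo (λ k → v (i + k)) n)) (length-applyUpTo _ n)

occ⇒factorAt : ∀ {A : Set} (v : Inf A) i x → Occ v i x → factorAt v i (length x) ≡ x
occ⇒factorAt v i x = occ-unique v i _ x (length-factorAt v i (length x)) (occ-factorAt v i (length x))

factor⇒occ : ∀ {A : Set} (v : Inf A) x → IsFactor v x → ∃[ i ] Occ v i x
factor⇒occ v x (i , eq) = i , subst (Occ v i) eq (occ-factorAt v i (length x))

occ⇒factor : ∀ {A : Set} (v : Inf A) i x → Occ v i x → IsFactor v x
occ⇒factor v i x o = i , occ⇒factorAt v i x o

occ-lookup : ∀ {A : Set} (v : Inf A) (d : A) i x → Occ v i x → ∀ k → k < length x → v (k + i) ≡ lookupD d x k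
occ-lookup v d i (a ∷ x) (e , o) zero    _       = e
occ-lookup v d i (a ∷ x) (e , o) (suc k) (s≤s l) = trans (cong v (sym (+-suc k i))) (occ-lookup v d (suc i) x o k l)

lookup-occ : ∀ {A : Set} (v : Inf A) (d : A) i x → (∀ k → k < length x → v (k + i) ≡ lookupD d x k) → Occ v i x
lookup-occ v d i []      _  = tt
lookup-occ v d i (a ∷ x) eq =
  eq 0 (s≤s z≤n) , lookup-occ v d (suc i) x (λ k l → trans (cong v (+-suc k i)) (eq (suc k) (s≤s l)))

lookupD-++ˡ : ∀ {A : Set} (d : A) x y k → k < length x → lookupD d (x ++ y) k ≡ lookupD d x k
lookupD-++ˡ d (a ∷ x) y zero    _       = refl
lookupD-++ˡ d (a ∷ x) y (suc k) (s≤s l) = lookupD-++ˡ d x y k l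

prefix-+ : ∀ {A : Set} (v : Inf A) m k → prefix v (m + k) ≡ prefix v m ++ factorAt v m k
prefix-+ v m k = occ-unique v 0 _ _
  (trans (length-factorAt v 0 (m + k))
    (sym (trans (length-++ (prefix v m)) (cong₂ _+_ (length-factorAt v 0 m) (length-factorAt v m k)))))
  (occ-factorAt v 0 (m + k))
  (occ-++⁺ v 0 (prefix v m) (occ-factorAt v 0 m)
    (subst (λ i → Occ v i (factorAt v m k)) (sym (trans (+-identityʳ _) (length-factorAt v 0 m))) (occ-factorAt v m k)))

prefix-suc : ∀ {A : Set} (v : Inf A) m → prefix v (suc m) ≡ v 0 ∷ prefix (v ∘ suc) m
prefix-suc v m = trans (map-upTo v (suc m)) (cong (v 0 ∷_) (sym (map-upTo (v ∘ suc) m)))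

-- Morphic images of infinite words

NonErasing : {A B : Set} → (A → Word B) → Set
NonErasing φ = ∀ a → 1 ≤ length (φ a)

morph-++ : ∀ {A B : Set} (φ : A → Word B) x y → morph φ (x ++ y) ≡ morph φ x ++ morph φ y
morph-++ φ = concatMap-++ φ

length-morph : ∀ {A B : Set} (φ : A → Word B) → NonErasing φ → ∀ x → length x ≤ length (morph φ x)
length-morph φ ne []      = z≤n
length-morph φ ne (a ∷ x) =
  ≤-trans (+-mono-≤ (ne a) (length-morph φ ne x)) (≤-reflexive (sym (length-++ (φ a))))

module _ {A : Set} {m : ℕ} (φ : A → Word (Fin (suc m))) (ne : NonErasing φ) where

  private
    lookup-image-≤ : ∀ u {a b} → a ≤ b → ∀ k → k < length (morph φ (prefix u a)) →
      lookupD zero (morph φ (prefix u b)) k ≡ lookupD zero (morph φ (prefix u a)) k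
    lookup-image-≤ u {a} {b} le k l = trans
      (cong (λ z → lookupD zero z k)
        (trans (cong (λ j → morph φ (prefix u j)) (sym (m+[n∸m]≡n le)))
          (trans (cong (morph φ) (prefix-+ u a (b ∸ a))) (morph-++ φ (prefix u a) _))))
      (lookupD-++ˡ zero (morph φ (prefix u a)) _ k l)

    -- Of two prefixes one extends the other, and so do their images; hence the letter at `k` is the
    -- same for every prefix whose image reaches beyond `k`.
    lookup-image : ∀ u a b k → k < length (morph φ (prefix u a)) → k < length (morph φ (prefix u b)) →
      lookupD zero (morph φ (prefix u a)) k ≡ lookupD zero (morph φ (prefix u b)) k
    lookup-image u a b k la lb with ≤-total a b
    ... | inj₁ le = sym (lookup-image-≤ u le k la)
    ... | inj₂ ge = lookup-image-≤ u ge k lb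

    -- This is where `φ` being non-erasing enters: the default value in `morphInf` is never read.
    long : ∀ u k → k < length (morph φ (prefix u (suc k)))
    long u k = ≤-trans (≤-reflexive (sym (length-factorAt u 0 (suc k)))) (length-morph φ ne (prefix u (suc k)))

  occ-morphInf : ∀ u y → Occ u 0 y → Occ (morphInf φ u) 0 (morph φ y)
  occ-morphInf u y o = subst (λ z → Occ (morphInf φ u) 0 (morph φ z)) (occ⇒factorAt u 0 y o)
    (lookup-occ _ zero 0 _ λ k l →
      trans (cong (morphInf φ u) (+-identityʳ k)) (lookup-image u (suc k) (length y) k (long u k) l))

  morphInf-final : ∀ w k u → (∀ n → Occ w k (morph φ (prefix u n))) → HasFinalSegment w (morphInf φ u)
  morphInf-final w k u o = k , λ i →
    trans (cong w (+-comm k i)) (occ-lookup w zero k _ (o (suc i)) i (long u i))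

  morphInf-finalSegment : ∀ u v → HasFinalSegment u v → HasFinalSegment (morphInf φ u) (morphInf φ v)
  morphInf-finalSegment u v (k , eq) = morphInf-final _ _ v λ n →
    occ-++⁻ʳ (morphInf φ u) 0 (morph φ (prefix u k))
      (subst (Occ (morphInf φ u) 0) (morph-++ φ (prefix u k) (prefix v n))
        (occ-morphInf u _
          (occ-++⁺ u 0 (prefix u k) (occ-factorAt u 0 k)
            (subst (λ j → Occ u j (prefix v n))
              (trans (+-identityʳ k) (sym (trans (+-identityʳ _) (length-factorAt u 0 k))))
              (occ-final u v k eq 0 (prefix v n) (occ-factorAt v 0 n))))))

finalSegment-trans : ∀ {A : Set} (u v z : Inf A) → HasFinalSegment u v → HasFinalSegment v z → HasFinalSegment u z
finalSegment-trans u v z (k , e) (j , e′) = k + j , λ i → trans (cong u (+-assoc k j i)) (trans (e (j + i)) (e′ i))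

dropInf : {A : Set} → ℕ → Inf A → Inf A
dropInf k u i = u (k + i)

dropInf-occ : ∀ {A : Set} (u : Inf A) k i x → Occ (dropInf k u) i x → Occ u (k + i) x
dropInf-occ u k = occ-final u (dropInf k u) k (λ _ → refl)

-- An infinite word in which every block boundary (a position satisfying P) is
-- followed by a block φ a and then by another boundary is a φ-image from there on.
module Desubstitution {A : Set} {m : ℕ} (φ : A → Word (Fin (suc m))) (ne : NonErasing φ)
  (v : Inf (Fin (suc m))) (P : ℕ → Set)
  (step : ∀ i → P i → ∃[ a ] (Occ v i (φ a) × P (length (φ a) + i))) where

  private
    -- The preimage is read off by walking from boundary to boundary; recursion on the index takes
    -- the place of a corecursive stream.
    letters : ∀ i → P i → Inf A
    letters i p zero    = proj₁ (step i p)
    letters i p (suc n) = letters _ (proj₂ (proj₂ (step i p))) n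

    occ-letters : ∀ n i p → Occ v i (morph φ (prefix (letters i p) n))
    occ-letters zero    i p = tt
    occ-letters (suc n) i p = subst (λ z → Occ v i (morph φ z)) (sym (prefix-suc (letters i p) n))
      (occ-++⁺ v i (φ (proj₁ (step i p))) (proj₁ (proj₂ (step i p))) (occ-letters n _ (proj₂ (proj₂ (step i p)))))

  desubstitute : ∀ i → P i → ∃[ u ] HasFinalSegment v (morphInf φ u)
  desubstitute i p = letters i p , morphInf-final φ ne v i _ (λ n → occ-letters n i p)

-- Powers of exponent larger than 5/2

pow : {A : Set} → Word A → Word A → Word A
pow x y = x ++ y ++ x ++ y ++ x

-- The word xyxyx has period |xy| and length 3|x| + 2|y|, which exceeds 5/2 of that period exactly
-- when |y| < |x|.
PowerFree : Inf Σ₂ → Set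
PowerFree w = ∀ i x y → length y < length x → ¬ Occ w i (pow x y)

nth-++ˡ⁻ : ∀ {A : Set} (x y : Word A) k {a} → k < length x → nth (x ++ y) k a → nth x k a
nth-++ˡ⁻ (b ∷ x) y zero    _       e = e
nth-++ˡ⁻ (b ∷ x) y (suc k) (s≤s l) e = nth-++ˡ⁻ x y k l e

nth-++ʳ⁺ : ∀ {A : Set} (x y : Word A) k {a} → nth y k a → nth (x ++ y) (length x + k) a
nth-++ʳ⁺ []      y k e = e
nth-++ʳ⁺ (b ∷ x) y k e = nth-++ʳ⁺ x y k e

-- By the equation, deleting the first |u| letters of the word `u ++ t` leaves `t`, which is also a
-- prefix of it.
shift-period : ∀ {A : Set} (u t r : Word A) → 1 ≤ length u → u ++ t ≡ t ++ r → IsPeriod (u ++ t) (length u)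
shift-period u t r pos eq = pos , ≤-trans (m≤m+n _ _) (≤-reflexive (sym (length-++ u))) , λ i a l e →
  subst (λ k → nth (u ++ t) k a) (+-comm (length u) i)
    (nth-++ʳ⁺ u t i (nth-++ˡ⁻ t r i
      (+-cancelˡ-< (length u) i _ (subst₂ _<_ (+-comm i (length u)) (length-++ u) l))
      (subst (λ z → nth z i a) eq e)))

-- `Avoids52Plus` speaks of smallest periods only. A period below `p` would satisfy the same
-- inequality, so well-founded descent shows that `p` may be taken to be smallest.
avoids-periods : ∀ {A : Set} (w : Inf A) → Avoids52Plus w → ∀ x → IsFactor w x → ∀ p → IsPeriod x p → ¬ 5 * p < 2 * length x
avoids-periods w av x fx p = go p (<-wellFounded p)
  where
  go : ∀ p → Acc _<_ p → IsPeriod x p → ¬ 5 * p < 2 * length x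
  go p (acc rs) per lt = av x fx (p , (per , minimal) , lt)
    where
    minimal : ∀ q → IsPeriod x q → p ≤ q
    minimal q perq with p ≤? q
    ... | yes p≤q = p≤q
    ... | no  p≰q = ⊥-elim (go q (rs (≰⇒> p≰q)) perq (≤-<-trans (*-monoʳ-≤ 5 (<⇒≤ (≰⇒> p≰q))) lt))

length-pow : ∀ {A : Set} (x y : Word A) → length (pow x y) ≡ length x + (length y + (length x + (length y + length x)))
length-pow x y =
  trans (length-++ x) (cong (length x +_)
    (trans (length-++ y) (cong (length y +_)
      (trans (length-++ x) (cong (length x +_) (length-++ y))))))

avoids⇒powerFree : ∀ w → Avoids52Plus w → PowerFree w
avoids⇒powerFree w av i x y lt o =
  avoids-periods w av (pow x y) (occ⇒factor w i _ o) (length (x ++ y)) period exponent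
  where
  split : (x ++ y) ++ (x ++ y ++ x) ≡ pow x y
  split = ++-assoc x y _
  period : IsPeriod (pow x y) (length (x ++ y))
  period = subst (λ z → IsPeriod z (length (x ++ y))) split
    -- The two factorisations compared are (xy)(xyx) and (xyx)(yx).
    (shift-period (x ++ y) (x ++ y ++ x) (y ++ x)
      (≤-trans (≤-trans (s≤s z≤n) lt) (≤-trans (m≤m+n _ _) (≤-reflexive (sym (length-++ x)))))
      (trans split (sym (trans (++-assoc x (y ++ x) _) (cong (x ++_) (++-assoc y x _))))))
  exponent : 5 * length (x ++ y) < 2 * length (pow x y)
  exponent = subst₂ _<_
    (trans (lhs (length x) (length y)) (cong (5 *_) (sym (length-++ x))))
    (trans (rhs (length x) (length y)) (cong (2 *_) (sym (length-pow x y))))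
    -- Adding 5|x| + 4|y| to both sides of |y| < |x| gives 5|xy| < 2|xyxyx|.
    (+-monoʳ-< (5 * length x + 4 * length y) lt)
    where
    open +-*-Solver
    lhs : ∀ a b → 5 * a + 4 * b + b ≡ 5 * (a + b)
    lhs = solve 2 (λ a b → con 5 :* a :+ con 4 :* b :+ b := con 5 :* (a :+ b)) refl
    rhs : ∀ a b → 5 * a + 4 * b + a ≡ 2 * (a + (b + (a + (b + a))))
    rhs = solve 2 (λ a b → con 5 :* a :+ con 4 :* b :+ a := con 2 :* (a :+ (b :+ (a :+ (b :+ a))))) refl

map-pow : ∀ {A B : Set} (t : A → B) x y → map t (pow x y) ≡ pow (map t x) (map t y)
map-pow t x y =
  trans (map-++ t x _) (cong (map t x ++_)
    (trans (map-++ t y _) (cong (map t y ++_)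
      (trans (map-++ t x _) (cong (map t x ++_) (map-++ t y x))))))

morph-pow : ∀ {A B : Set} (φ : A → Word B) x y → morph φ (pow x y) ≡ pow (morph φ x) (morph φ y)
morph-pow φ x y =
  trans (morph-++ φ x _) (cong (morph φ x ++_)
    (trans (morph-++ φ y _) (cong (morph φ y ++_)
      (trans (morph-++ φ x _) (cong (morph φ x ++_) (morph-++ φ y x))))))

reverse-pow : ∀ {A : Set} (x y : Word A) → reverse (pow x y) ≡ pow (reverse x) (reverse y)
reverse-pow x y = begin
  reverse (x ++ y ++ x ++ y ++ x)
    ≡⟨ reverse-++ x _ ⟩
  reverse (y ++ x ++ y ++ x) ++ x′
    ≡⟨ cong (_++ x′) (reverse-++ y _) ⟩
  (reverse (x ++ y ++ x) ++ y′) ++ x′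
    ≡⟨ cong (λ z → (z ++ y′) ++ x′) (reverse-++ x _) ⟩
  ((reverse (y ++ x) ++ x′) ++ y′) ++ x′
    ≡⟨ cong (λ z → ((z ++ x′) ++ y′) ++ x′) (reverse-++ y x) ⟩
  (((x′ ++ y′) ++ x′) ++ y′) ++ x′
    ≡⟨ ++-assoc ((x′ ++ y′) ++ x′) y′ x′ ⟩
  ((x′ ++ y′) ++ x′) ++ y′ ++ x′
    ≡⟨ ++-assoc (x′ ++ y′) x′ _ ⟩
  (x′ ++ y′) ++ x′ ++ y′ ++ x′
    ≡⟨ ++-assoc x′ y′ _ ⟩
  pow x′ y′ ∎
  where
  open ≡-Reasoning
  x′ = reverse x
  y′ = reverse y

-- Counting the factors of a Rote word

-- Pigeonhole: the head of `xs` is deleted from `ys`, and by uniqueness the tail of `xs` never meets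
-- the deleted entry.
unique-length : ∀ {A : Set} {xs ys : List A} → Unique xs → (∀ {x} → x ∈ xs → x ∈ ys) → length xs ≤ length ys
unique-length {xs = []}     _       _   = z≤n
unique-length {xs = x ∷ xs} (x≢ ∷ u) sub with ∈-∃++ (sub (here refl))
... | l , r , refl = ≤-trans (s≤s (unique-length u sub′))
  (≤-reflexive (trans (cong suc (length-++ l)) (sym (trans (length-++ l) (+-suc (length l) (length r))))))
  where
  sub′ : ∀ {y} → y ∈ xs → y ∈ l ++ r
  sub′ y∈ with ∈-++⁻ l (sub (there y∈))
  ... | inj₁ y∈l          = ∈-++⁺ˡ y∈l
  ... | inj₂ (here refl)  = ⊥-elim (All.lookup x≢ y∈ refl)
  ... | inj₂ (there y∈r)  = ∈-++⁺ʳ l y∈r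

rote-bound : ∀ w → Rote w → ∀ n → 1 ≤ n → ∀ s → Unique s → (∀ {x} → x ∈ s → IsFactor w x × length x ≡ n) → length s ≤ 2 * n
rote-bound w rote n n≥1 s u fs with rote n n≥1
... | l , _ , len , iff = ≤-trans (unique-length u (λ x∈ → Equivalence.from (iff _) (fs x∈))) (≤-reflexive len)

-- Eight known factors already exhaust the bound 2 * 4; one outside `s` would be a ninth.
rote-factors4 : ∀ w → Rote w → ∀ s → Unique s → length s ≡ 8 → All (λ x → length x ≡ 4) s →
  (∀ {x} → x ∈ s → IsFactor w x) → Factors4Are w s
rote-factors4 w rote s u len len4 fs x lx = mk⇔ to fs
  where
  to : IsFactor w x → x ∈ s
  to fx with x ∈? s
  ... | yes x∈ = x∈
  ... | no  x∉ = ⊥-elim (<⇒≱ (≤-reflexive (cong suc (sym len)))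
    (rote-bound w rote 4 (s≤s z≤n) (x ∷ s) (All.tabulate (λ y∈ e → x∉ (subst (_∈ s) (sym e) y∈)) ∷ u)
      λ { (here refl) → fx , lx ; (there y∈) → fs y∈ , All.lookup len4 y∈ }))

-- Exhaustive search for the set of factors of length 4

∨-true : ∀ a {b} → a ∨ b ≡ true → a ≡ true ⊎ b ≡ true
∨-true true  _ = inj₁ refl
∨-true false e = inj₂ e

∧-true : ∀ a {b} → a ∧ b ≡ true → a ≡ true × b ≡ true
∧-true true e = refl , e

does-true : ∀ {P : Set} (d : Dec P) → does d ≡ true → P
does-true (yes p) _ = p

prefixOf : Word Σ₂ → Word Σ₂ → Bool
prefixOf []      _       = true
prefixOf (_ ∷ _) []      = false
prefixOf (a ∷ x) (b ∷ z) = does (a ≟ b) ∧ prefixOf x z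

prefixOf-sound : ∀ x z → prefixOf x z ≡ true → ∃[ s ] z ≡ x ++ s
prefixOf-sound []      z       _ = z , refl
prefixOf-sound (a ∷ x) (b ∷ z) e with ∧-true (does (a ≟ b)) e
... | e₁ , e₂ with does-true (a ≟ b) e₁ | prefixOf-sound x z e₂
... | refl | s , refl = s , refl

-- The first two blocks are x and y by construction, so only the remaining xyx is compared. The
-- length comparison keeps the test sound when `z` is too short for `take` to deliver full blocks.
powerOfShape : ℕ → ℕ → Word Σ₂ → Bool
powerOfShape a b z =
  prefixOf (take a z ++ take b (drop a z) ++ take a z) (drop b (drop a z))
  ∧ (length (take b (drop a z)) <ᵇ length (take a z))

-- A power of exponent larger than 5/2 and period p has a prefix xyxyx with
-- |xy| = p and |x| - |y| ∈ {1, 2}, so only these shapes are tried.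
startsWithPower : ℕ → Word Σ₂ → Bool
startsWithPower zero    z = false
startsWithPower (suc a) z = powerOfShape (suc a) a z ∨ powerOfShape (suc a) (a ∸ 1) z ∨ startsWithPower a z

StartsWithPower : Word Σ₂ → Set
StartsWithPower z = ∃₂ λ x y → ∃[ s ] (z ≡ pow x y ++ s × length y < length x)

powerOfShape-sound : ∀ a b z → powerOfShape a b z ≡ true → StartsWithPower z
powerOfShape-sound a b z e = x , y , s , eq , <ᵇ⇒< _ _ (subst T (sym (proj₂ both)) tt)
  where
  x = take a z
  y = take b (drop a z)
  both = ∧-true (prefixOf (x ++ y ++ x) (drop b (drop a z))) e
  found = prefixOf-sound (x ++ y ++ x) _ (proj₁ both)
  s = proj₁ found
  open ≡-Reasoning
  eq : z ≡ pow x y ++ s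
  eq = begin
    z                               ≡⟨ take++drop≡id a z ⟨
    x ++ drop a z                   ≡⟨ cong (x ++_) (take++drop≡id b (drop a z)) ⟨
    x ++ y ++ drop b (drop a z)     ≡⟨ cong (λ t → x ++ y ++ t) (proj₂ found) ⟩
    x ++ y ++ (x ++ y ++ x) ++ s    ≡⟨ cong (x ++_) (++-assoc y (x ++ y ++ x) s) ⟨
    x ++ (y ++ x ++ y ++ x) ++ s    ≡⟨ ++-assoc x (y ++ x ++ y ++ x) s ⟨
    pow x y ++ s                    ∎

startsWithPower-sound : ∀ a z → startsWithPower a z ≡ true → StartsWithPower z
startsWithPower-sound (suc a) z e with ∨-true (powerOfShape (suc a) a z) e
... | inj₁ e₁ = powerOfShape-sound (suc a) a z e₁
... | inj₂ e₂ with ∨-true (powerOfShape (suc a) (a ∸ 1) z) e₂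
... | inj₁ e₃ = powerOfShape-sound (suc a) (a ∸ 1) z e₃
... | inj₂ e₄ = startsWithPower-sound a z e₄

note : ℕ → Word Σ₂ → List (Word Σ₂) → List (Word Σ₂)
note k r s = if (k ≤ᵇ length r) ∧ not (does (take k r ∈? s)) then take k r ∷ s else s

targets : List (List (Word Σ₂))
targets = Fset ∷ compSet Fset ∷ revSet Fset ∷ compSet (revSet Fset) ∷ []

coversTarget : ∀ s → Dec (Any (All (_∈ s)) targets)
coversTarget s = Any.any? (All.all? (_∈? s)) targets

-- r is the reversal of a prefix of the word; s₄ and s₈ list the reversals of
-- the factors of length 4 and 8 of that prefix. The bound 16 on s₈ makes the
-- search tree finite (depth 54); the bound 8 on s₄ halves it.
search extend : ℕ → Word Σ₂ → List (Word Σ₂) → List (Word Σ₂) → Bool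
search n r s₄ s₈ = startsWithPower 10 r ∨ ((8 <ᵇ length s₄) ∨ (16 <ᵇ length s₈)) ∨
  ((length s₄ ≡ᵇ 8) ∧ does (coversTarget s₄)) ∨ extend n r s₄ s₈
extend zero    r s₄ s₈ = false
extend (suc n) r s₄ s₈ = continue O ∧ continue I
  where
  continue : Σ₂ → Bool
  continue a = search n (a ∷ r) (note 4 (a ∷ r) s₄) (note 8 (a ∷ r) s₈)

-- The search is evaluated by the type checker. Exhausted fuel counts as failure, so `true`
-- certifies that every branch is closed within 60 letters.
search-succeeds : search 60 [] [] [] ≡ true
search-succeeds = refl

module SearchSound (w : Inf Σ₂) (rote : Rote w) (pf : PowerFree w) where

  -- The entries are reversed factors, because the explored prefix is stored with its newest letter
  -- first.
  Seen : ℕ → List (Word Σ₂) → Set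
  Seen k s = Unique s × (∀ {x} → x ∈ s → IsFactor w (reverse x) × length x ≡ k)

  note-seen : ∀ k r s → Occ w 0 (reverse r) → Seen k s → Seen k (note k r s)
  note-seen k r s o (u , fs) with k ≤ᵇ length r in k≤ | take k r ∈? s
  ... | false | _     = u , fs
  ... | true  | yes _ = u , fs
  ... | true  | no x∉ =
    (All.tabulate (λ y∈ e → x∉ (subst (_∈ s) (sym e) y∈)) ∷ u) ,
    λ { (here refl) → occ⇒factor w _ _ (occ-++⁻ʳ w 0 (reverse (drop k r)) (subst (Occ w 0) split o)) ,
                      trans (length-take k r) (m≤n⇒m⊓n≡m (≤ᵇ⇒≤ k _ (subst T (sym k≤) tt)))
      ; (there y∈)  → fs y∈ }
    where
    split : reverse r ≡ reverse (drop k r) ++ reverse (take k r)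
    split = trans (cong reverse (sym (take++drop≡id k r))) (reverse-++ (take k r) (drop k r))

  seen-bound : ∀ k → 1 ≤ k → ∀ s → Seen k s → (2 * k <ᵇ length s) ≡ true → ⊥
  seen-bound k k≥1 s (u , fs) e = <⇒≱ (<ᵇ⇒< (2 * k) _ (subst T (sym e) tt))
    (subst (_≤ 2 * k) (length-map reverse s)
      (rote-bound w rote k k≥1 (map reverse s) (UniqueP.map⁺ reverse-injective u) facts))
    where
    facts : ∀ {x} → x ∈ map reverse s → IsFactor w x × length x ≡ k
    facts x∈ with ∈-map⁻ reverse x∈
    ... | y , y∈ , refl = proj₁ (fs y∈) , trans (length-reverse y) (proj₂ (fs y∈))

  Found : Set
  Found = Any (All (IsFactor w ∘ reverse)) targets

  occ-step : ∀ r a → w (length r) ≡ a → Occ w 0 (reverse r) → Occ w 0 (reverse (a ∷ r))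
  occ-step r a e o = subst (Occ w 0) (sym (unfold-reverse a r))
    (occ-++⁺ w 0 (reverse r) o (trans (cong w (trans (+-identityʳ _) (length-reverse r))) e , tt))

  -- The search tree is descended along the branch that `w` itself spells. A power or too many
  -- factors contradicts the hypotheses on `w`, so the branch must end at a covered target.
  search-sound : ∀ n r s₄ s₈ → search n r s₄ s₈ ≡ true → Occ w 0 (reverse r) → Seen 4 s₄ → Seen 8 s₈ → Found
  extend-sound : ∀ n r s₄ s₈ → extend n r s₄ s₈ ≡ true → Occ w 0 (reverse r) → Seen 4 s₄ → Seen 8 s₈ → Found

  search-sound n r s₄ s₈ e o h₄ h₈ with ∨-true (startsWithPower 10 r) e
  ... | inj₁ e₁ with startsWithPower-sound 10 r e₁
  -- A power at the front of `r` is, reversed, a power that ends at the newest letter of the prefix.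
  ... | x , y , s , refl , lt = ⊥-elim (pf _ (reverse x) (reverse y)
    (subst₂ _<_ (sym (length-reverse y)) (sym (length-reverse x)) lt)
    (subst (Occ w _) (reverse-pow x y)
      (occ-++⁻ʳ w 0 (reverse s) (subst (Occ w 0) (reverse-++ (pow x y) s) o))))
  search-sound n r s₄ s₈ e o h₄ h₈ | inj₂ e₂
    with ∨-true ((8 <ᵇ length s₄) ∨ (16 <ᵇ length s₈)) e₂
  ... | inj₁ e₃ with ∨-true (8 <ᵇ length s₄) e₃
  ...   | inj₁ e₄ = ⊥-elim (seen-bound 4 (s≤s z≤n) s₄ h₄ e₄)
  ...   | inj₂ e₈ = ⊥-elim (seen-bound 8 (s≤s z≤n) s₈ h₈ e₈)
  search-sound n r s₄ s₈ e o h₄ h₈ | inj₂ e₂ | inj₂ e₅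
    with ∨-true ((length s₄ ≡ᵇ 8) ∧ does (coversTarget s₄)) e₅
  ... | inj₁ e₆ = Any.map (All.map (λ x∈ → proj₁ (proj₂ h₄ x∈)))
    (does-true (coversTarget s₄) (proj₂ (∧-true (length s₄ ≡ᵇ 8) e₆)))
  ... | inj₂ e₇ = extend-sound n r s₄ s₈ e₇ o h₄ h₈

  -- Both children of the node succeed; the letter of `w` after the prefix selects the one to
  -- follow.
  extend-sound (suc n) r s₄ s₈ e o h₄ h₈ = go (w (length r)) refl
    where
    both = ∧-true (search n (O ∷ r) (note 4 (O ∷ r) s₄) (note 8 (O ∷ r) s₈)) e
    next : ∀ a → w (length r) ≡ a → search n (a ∷ r) (note 4 (a ∷ r) s₄) (note 8 (a ∷ r) s₈) ≡ true → Found
    next a ea es = search-sound n (a ∷ r) _ _ es o′ (note-seen 4 (a ∷ r) s₄ o′ h₄) (note-seen 8 (a ∷ r) s₈ o′ h₈)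
      where o′ = occ-step r a ea o
    go : ∀ a → w (length r) ≡ a → Found
    go 0F ea = next 0F ea (proj₁ both)
    go 1F ea = next 1F ea (proj₂ both)

  found : Found
  found = search-sound 60 [] [] [] search-succeeds tt ([] , λ ()) ([] , λ ())

  factors4 : ∀ s → True (unique? s) → length s ≡ 8 → True (All.all? (λ x → length x ≟ℕ 4) s) →
    All (IsFactor w) s → Factors4Are w s
  factors4 s u len len4 fs = rote-factors4 w rote s (toWitness u) len (toWitness len4) (All.lookup fs)

factors4-cases : ∀ w → Rote w → PowerFree w →
  Factors4Are w Fset ⊎ Factors4Are w (compSet Fset) ⊎ Factors4Are w (revSet Fset) ⊎ Factors4Are w (compSet (revSet Fset))
factors4-cases w rote pf = cases found
  where
  open SearchSound w rote pf
  cases : Found → _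
  -- `Found` concerns reversed factors, so each target stands for its reversal: `Fset` is swapped
  -- with `revSet Fset`, and `compSet Fset` with `compSet (revSet Fset)`.
  cases (here fs)                         = inj₂ (inj₂ (inj₁ (factors4 (revSet Fset) tt refl tt (AllP.map⁺ fs))))
  cases (there (here fs))                 = inj₂ (inj₂ (inj₂ (factors4 (compSet (revSet Fset)) tt refl tt (AllP.map⁺ fs))))
  cases (there (there (here fs)))         = inj₁ (factors4 Fset tt refl tt (AllP.map⁺ fs))
  cases (there (there (there (here fs)))) = inj₂ (inj₁ (factors4 (compSet Fset) tt refl tt (AllP.map⁺ fs)))

-- Finite words whose images are free of bad factors are proper

image : (Σ₃ → Word Σ₃) → ℕ → Word Σ₃ → Word Σ₂
image φ n z = morph g (iter n (morph φ) z)

iter-++ : ∀ (φ : Σ₃ → Word Σ₃) n x y → iter n (morph φ) (x ++ y) ≡ iter n (morph φ) x ++ iter n (morph φ) y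
iter-++ φ zero    x y = refl
iter-++ φ (suc n) x y = trans (cong (morph φ) (iter-++ φ n x y)) (morph-++ φ (iter n (morph φ) x) _)

iter-comm : ∀ {A : Set} n (t : A → A) a → iter n t (t a) ≡ t (iter n t a)
iter-comm zero    t a = refl
iter-comm (suc n) t a = cong t (iter-comm n t a)

image-++ : ∀ φ n x y → image φ n (x ++ y) ≡ image φ n x ++ image φ n y
image-++ φ n x y = trans (cong (morph g) (iter-++ φ n x y)) (morph-++ g (iter n (morph φ) x) _)

image-infix : ∀ φ n p x s → image φ n (p ++ x ++ s) ≡ image φ n p ++ image φ n x ++ image φ n s
image-infix φ n p x s = trans (image-++ φ n p _) (cong (image φ n p ++_) (image-++ φ n x s))

-- Parikh vectors under `f` and lengths under `g`

count₀-f : ∀ u → count 0F (morph f u) ≡ count 0F u + count 1F u + count 2F u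
count₀-f []       = refl
count₀-f (0F ∷ u) = cong suc (count₀-f u)
count₀-f (1F ∷ u) = trans (cong suc (count₀-f u)) (cong (_+ count 2F u) (sym (+-suc (count 0F u) _)))
count₀-f (2F ∷ u) = trans (cong suc (count₀-f u)) (sym (+-suc (count 0F u + count 1F u) _))

count₁-f : ∀ u → count 1F (morph f u) ≡ count 0F u + (count 0F u + count 1F u + count 2F u)
count₁-f []       = refl
count₁-f (0F ∷ u) = cong suc (trans (cong suc (count₁-f u)) (sym (+-suc (count 0F u) _)))
count₁-f (1F ∷ u) = trans (cong suc (count₁-f u)) (trans (sym (+-suc (count 0F u) _))
  (cong (λ k → count 0F u + (k + count 2F u)) (sym (+-suc (count 0F u) _))))
count₁-f (2F ∷ u) = trans (cong suc (count₁-f u)) (trans (sym (+-suc (count 0F u) _))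
  (cong (count 0F u +_) (sym (+-suc (count 0F u + count 1F u) _))))

count₂-f : ∀ u → count 2F (morph f u) ≡ count 0F u + count 1F u
count₂-f []       = refl
count₂-f (0F ∷ u) = cong suc (count₂-f u)
count₂-f (1F ∷ u) = trans (cong suc (count₂-f u)) (sym (+-suc (count 0F u) _))
count₂-f (2F ∷ u) = count₂-f u

-- The block lengths 3, 1, 2 are split into the total letter count, which increases strictly under
-- `ParikhGt`, and a remainder that is monotone.
length-g : ∀ u → length (morph g u) ≡ (count 0F u + count 1F u + count 2F u) + (count 0F u + count 0F u + count 2F u)
length-g []       = refl
length-g (0F ∷ u) = trans (cong (3 +_) (length-g u)) (solve 3 (λ a b c →
  con 3 :+ ((a :+ b :+ c) :+ (a :+ a :+ c)) :=
  ((con 1 :+ a) :+ b :+ c) :+ ((con 1 :+ a) :+ (con 1 :+ a) :+ c)) refl (count 0F u) (count 1F u) (count 2F u))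
  where open +-*-Solver
length-g (1F ∷ u) = trans (cong suc (length-g u)) (solve 3 (λ a b c →
  con 1 :+ ((a :+ b :+ c) :+ (a :+ a :+ c)) :=
  (a :+ (con 1 :+ b) :+ c) :+ (a :+ a :+ c)) refl (count 0F u) (count 1F u) (count 2F u))
  where open +-*-Solver
length-g (2F ∷ u) = trans (cong (2 +_) (length-g u)) (solve 3 (λ a b c →
  con 2 :+ ((a :+ b :+ c) :+ (a :+ a :+ c)) :=
  (a :+ b :+ (con 1 :+ c)) :+ (a :+ a :+ (con 1 :+ c))) refl (count 0F u) (count 1F u) (count 2F u))
  where open +-*-Solver

parikhGt-total : ∀ x y → ParikhGt x y → count 0F y + count 1F y + count 2F y < count 0F x + count 1F x + count 2F x
parikhGt-total x y (le , 0F , lt) = +-mono-<-≤ (+-mono-<-≤ lt (le 1F)) (le 2F)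
parikhGt-total x y (le , 1F , lt) = +-mono-<-≤ (+-mono-≤-< (le 0F) lt) (le 2F)
parikhGt-total x y (le , 2F , lt) = +-mono-≤-< (+-mono-≤ (le 0F) (le 1F)) lt

-- Every block of `f` contains exactly one 0, so a strict increase in any coordinate becomes a
-- strict increase in the number of 0s. The other two rows of the incidence matrix are monotone.
parikhGt-f : ∀ x y → ParikhGt x y → ParikhGt (morph f x) (morph f y)
parikhGt-f x y gt@(le , _) = le′ , 0F , subst₂ _<_ (sym (count₀-f y)) (sym (count₀-f x)) total
  where
  total = parikhGt-total x y gt
  le′ : ∀ a → count a (morph f y) ≤ count a (morph f x)
  le′ 0F = subst₂ _≤_ (sym (count₀-f y)) (sym (count₀-f x)) (<⇒≤ total)
  le′ 1F = subst₂ _≤_ (sym (count₁-f y)) (sym (count₁-f x)) (+-mono-≤ (le 0F) (<⇒≤ total))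
  le′ 2F = subst₂ _≤_ (sym (count₂-f y)) (sym (count₂-f x)) (+-mono-≤ (le 0F) (le 1F))

parikhGt-iter : ∀ n x y → ParikhGt x y → ParikhGt (iter n (morph f) x) (iter n (morph f) y)
parikhGt-iter zero    x y gt = gt
parikhGt-iter (suc n) x y gt =
  parikhGt-f (iter n (morph f) x) (iter n (morph f) y) (parikhGt-iter n x y gt)

parikhGt-length : ∀ x y → ParikhGt x y → length (morph g y) < length (morph g x)
parikhGt-length x y gt@(le , _) = subst₂ _<_ (sym (length-g y)) (sym (length-g x))
  (+-mono-<-≤ (parikhGt-total x y gt) (+-mono-≤ (+-mono-≤ (le 0F) (le 0F)) (le 2F)))

-- These are the two obstructions that a power-free word with length-4 factors `Fset` cannot
-- contain. Both are inherited by longer words.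
data Bad (z : Word Σ₂) : Set where
  power : ∀ p x y s → z ≡ p ++ pow x y ++ s → length y < length x → Bad z
  alien : ∀ p q s → z ≡ p ++ q ++ s → length q ≡ 4 → q ∉ Fset → Bad z

infix-trans : ∀ {A : Set} (p p′ x s′ s : List A) → p ++ (p′ ++ x ++ s′) ++ s ≡ (p ++ p′) ++ x ++ (s′ ++ s)
infix-trans p p′ x s′ s = begin
  p ++ (p′ ++ x ++ s′) ++ s   ≡⟨ cong (p ++_) (++-assoc p′ (x ++ s′) s) ⟩
  p ++ p′ ++ (x ++ s′) ++ s   ≡⟨ cong (λ t → p ++ p′ ++ t) (++-assoc x s′ s) ⟩
  p ++ p′ ++ x ++ (s′ ++ s)   ≡⟨ ++-assoc p p′ _ ⟨
  (p ++ p′) ++ x ++ (s′ ++ s) ∎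
  where open ≡-Reasoning

bad-infix : ∀ p {z} s → Bad z → Bad (p ++ z ++ s)
bad-infix p s (power p′ x y s′ refl lt)   = power (p ++ p′) x y (s′ ++ s) (infix-trans p p′ (pow x y) s′ s) lt
bad-infix p s (alien p′ q s′ refl len q∉) = alien (p ++ p′) q (s′ ++ s) (infix-trans p p′ q s′ s) len q∉

isAlien : Word Σ₂ → Bool
isAlien q = (length q ≡ᵇ 4) ∧ not (does (q ∈? Fset))

-- A sound test that tries only powers with |x| at most 9, which is enough for the words in
-- `smallLevels`.
hasBad : Word Σ₂ → Bool
hasBad []      = false
hasBad (a ∷ z) = isAlien (take 4 (a ∷ z)) ∨ startsWithPower 9 (a ∷ z) ∨ hasBad z

hasBad-sound : ∀ z → hasBad z ≡ true → Bad z
hasBad-sound z@(a ∷ z′) e with ∨-true (isAlien (take 4 z)) e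
... | inj₁ e₁ = alien [] (take 4 z) (drop 4 z) (sym (take++drop≡id 4 z))
  (≡ᵇ⇒≡ _ 4 (subst T (sym (proj₁ both)) tt)) (not-does (take 4 z ∈? Fset) (proj₂ both))
  where
  both = ∧-true (length (take 4 z) ≡ᵇ 4) e₁
  not-does : ∀ {P : Set} (d : Dec P) → not (does d) ≡ true → ¬ P
  not-does (no ¬p) _ = ¬p
... | inj₂ e₂ with ∨-true (startsWithPower 9 z) e₂
...   | inj₁ e₃ with startsWithPower-sound 9 z e₃
...     | x , y , s , eq , lt = power [] x y s eq lt
hasBad-sound z@(a ∷ z′) e | inj₂ e₂ | inj₂ e₄ =
  subst Bad (cong (a ∷_) (++-identityʳ z′)) (bad-infix [ a ] [] (hasBad-sound z′ e₄))

-- Iterating `f` preserves π(x) > π(y), and `g` turns this into an inequality of lengths, so the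
-- image is again of the form xyxyx with |y| < |x|.
power-image : ∀ n p x y s → ParikhGt x y → Bad (image f n (p ++ pow x y ++ s))
power-image n p x y s gt = power (image f n p) (image f n x) (image f n y) (image f n s)
  (trans (image-infix f n p (pow x y) s)
    (cong (λ t → image f n p ++ t ++ image f n s) (trans (cong (morph g) (iter-pow n)) (morph-pow g (iter n (morph f) x) (iter n (morph f) y)))))
  (parikhGt-length (iter n (morph f) x) (iter n (morph f) y) (parikhGt-iter n x y gt))
  where
  iter-pow : ∀ n → iter n (morph f) (pow x y) ≡ pow (iter n (morph f) x) (iter n (morph f) y)
  iter-pow zero    = refl
  iter-pow (suc n) = trans (cong (morph f) (iter-pow n)) (morph-pow f (iter n (morph f) x) (iter n (morph f) y))

-- The images of every letter under f² end in 1021 and begin with 01210, so an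
-- inner occurrence of f²(v) in an f²-image extends to an occurrence of core v.
core : Word Σ₃ → Word Σ₃
core v = (1F ∷ 0F ∷ 2F ∷ 1F ∷ []) ++ morph f (morph f v) ++ (0F ∷ 1F ∷ 2F ∷ 1F ∷ 0F ∷ [])

data CorePower (v : Word Σ₃) : Set where
  corePower : ∀ x y s → core v ≡ pow x y ++ s → ParikhGt x y → CorePower v

corePower? : ∀ {v} a b → let x = take a (core v) ; y = take b (drop a (core v)) ; s = drop (length (pow x y)) (core v) in
  {_ : True (≡-dec _≟_ (core v) (pow x y ++ s) ×-dec
             (allFin? (λ c → count c y ≤? count c x) ×-dec anyFin? (λ c → count c y <? count c x)))} → CorePower v
corePower? {v} a b {t} = corePower (take a (core v)) (take b (drop a (core v))) _ (proj₁ (toWitness t)) (proj₂ (toWitness t))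

-- The numbers are |x| and |y|. Their sum is the length of f² of the word being repeated, which is
-- 0, 1, 2, 2, 10, 21 and 102 in turn, where f² of the letters 0, 1, 2 has length 12, 9, 7. For 20,
-- f²(2) is a prefix of f²(0).
forbidden-core : All CorePower forbidden
forbidden-core = corePower? 9 3 ∷ corePower? 9 0 ∷ corePower? 7 0 ∷ corePower? 6 1 ∷
                 corePower? 18 3 ∷ corePower? 9 7 ∷ corePower? 28 0 ∷ []

f²-suffix : ∀ a → ∃[ t ] morph f (morph f [ a ]) ≡ t ++ (1F ∷ 0F ∷ 2F ∷ 1F ∷ [])
f²-suffix 0F = 0F ∷ 1F ∷ 2F ∷ 1F ∷ 0F ∷ 2F ∷ 1F ∷ 0F ∷ [] , refl
f²-suffix 1F = 0F ∷ 1F ∷ 2F ∷ 1F ∷ 0F ∷ [] , refl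
f²-suffix 2F = 0F ∷ 1F ∷ 2F ∷ [] , refl

f²-prefix : ∀ a → ∃[ t ] morph f (morph f [ a ]) ≡ (0F ∷ 1F ∷ 2F ∷ 1F ∷ 0F ∷ []) ++ t
f²-prefix 0F = _ , refl
f²-prefix 1F = _ , refl
f²-prefix 2F = _ , refl

f²-infix : ∀ a v b → ∃₂ λ p s → morph f (morph f (a ∷ v ++ [ b ])) ≡ p ++ core v ++ s
f²-infix a v b with f²-suffix a | f²-prefix b
... | p , ep | s , es = p , s , (begin
  F² ([ a ] ++ v ++ [ b ])                ≡⟨ F²-++ [ a ] (v ++ [ b ]) ⟩
  F² [ a ] ++ F² (v ++ [ b ])             ≡⟨ cong₂ _++_ ep (trans (F²-++ v [ b ]) (cong (F² v ++_) es)) ⟩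
  (p ++ l) ++ F² v ++ (r ++ s)            ≡⟨ infix-trans p l (F² v) r s ⟨
  p ++ core v ++ s                        ∎)
  where
  open ≡-Reasoning
  F² = λ z → morph f (morph f z)
  F²-++ : ∀ x y → F² (x ++ y) ≡ F² x ++ F² y
  F²-++ = iter-++ f 2
  l = 1F ∷ 0F ∷ 2F ∷ 1F ∷ []
  r = 0F ∷ 1F ∷ 2F ∷ 1F ∷ 0F ∷ []

-- Below level 2 the letters around a forbidden word are not determined enough,
-- so all margins are tried.
smallLevels : All (λ v → ∀ a b c →
  hasBad (image f 0 (a ∷ v ++ b ∷ c ∷ [])) ∧ hasBad (image f 1 (a ∷ v ++ b ∷ c ∷ [])) ≡ true) forbidden
smallLevels = from-yes (All.all? (λ v → allFin? (λ a → allFin? (λ b → allFin? (λ c →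
  hasBad (image f 0 (a ∷ v ++ b ∷ c ∷ [])) ∧ hasBad (image f 1 (a ∷ v ++ b ∷ c ∷ [])) ≟ᵇ true)))) forbidden)

smallLevel-bad : ∀ {v} → v ∈ forbidden → ∀ a b c →
  Bad (image f 0 (a ∷ v ++ b ∷ c ∷ [])) × Bad (image f 1 (a ∷ v ++ b ∷ c ∷ []))
smallLevel-bad {v} v∈ a b c = hasBad-sound _ (proj₁ both) , hasBad-sound _ (proj₂ both)
  where both = ∧-true (hasBad (image f 0 (a ∷ v ++ b ∷ c ∷ []))) (All.lookup smallLevels v∈ a b c)

-- From level 2 on, two applications of `f` produce a core with an xyxyx such that π(x) > π(y), and
-- `power-image` carries it through the remaining levels.
forbidden-bad : ∀ n {v} → v ∈ forbidden → ∀ a b c → Bad (image f n (a ∷ v ++ b ∷ c ∷ []))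
forbidden-bad zero          v∈ a b c = proj₁ (smallLevel-bad v∈ a b c)
forbidden-bad (suc zero)    v∈ a b c = proj₂ (smallLevel-bad v∈ a b c)
forbidden-bad (suc (suc n)) {v} v∈ a b c with f²-infix a v b | All.lookup forbidden-core v∈
... | p , s , ep | corePower x y s′ ec gt =
  subst Bad (sym eq) (bad-infix [] (image f (2 + n) [ c ]) (power-image n p x y (s′ ++ s) gt))
  where
  open ≡-Reasoning
  eq : image f (2 + n) (a ∷ v ++ b ∷ c ∷ []) ≡ image f n (p ++ pow x y ++ s′ ++ s) ++ image f (2 + n) [ c ]
  eq = begin
    image f (2 + n) (a ∷ v ++ b ∷ c ∷ [])
      ≡⟨ cong (λ t → image f (2 + n) (a ∷ t)) (++-assoc v [ b ] [ c ]) ⟨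
    image f (2 + n) ((a ∷ v ++ [ b ]) ++ [ c ])
      ≡⟨ image-++ f (2 + n) (a ∷ v ++ [ b ]) [ c ] ⟩
    image f (2 + n) (a ∷ v ++ [ b ]) ++ image f (2 + n) [ c ]
      -- `iter` adds new applications on the outside; `iter-comm`, used twice, moves two of them
      -- next to the argument.
      ≡⟨ cong (λ t → morph g t ++ image f (2 + n) [ c ])
           (trans (cong (morph f) (sym (iter-comm n (morph f) _))) (sym (iter-comm n (morph f) _))) ⟩
    image f n (morph f (morph f (a ∷ v ++ [ b ]))) ++ image f (2 + n) [ c ]
      ≡⟨ cong (λ t → image f n t ++ image f (2 + n) [ c ])
           (trans ep (cong (p ++_) (trans (cong (_++ s) ec) (++-assoc (pow x y) s′ s)))) ⟩
    image f n (p ++ pow x y ++ s′ ++ s) ++ image f (2 + n) [ c ]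
      ∎

last₁ : ∀ {A : Set} (l : List A) → 1 ≤ length l → ∃₂ λ p a → l ≡ p ++ [ a ]
last₁ (a ∷ [])    _ = [] , a , refl
last₁ (a ∷ b ∷ l) _ with last₁ (b ∷ l) (s≤s z≤n)
... | p , c , eq = a ∷ p , c , cong (a ∷_) eq

forbidden-inner-bad : ∀ n l {v} r → 2 ≤ length l → 2 ≤ length r → v ∈ forbidden → Bad (image f n (l ++ v ++ r))
forbidden-inner-bad n l {v} (b ∷ [])    ll (s≤s ()) v∈
forbidden-inner-bad n l {v} (b ∷ c ∷ s) ll lr v∈ with last₁ l (<⇒≤ ll)
... | p , a , refl = subst Bad (sym (trans (cong (image f n) eq) (image-infix f n p _ s)))
  (bad-infix (image f n p) (image f n s) (forbidden-bad n v∈ a b c))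
  where
  eq : (p ++ [ a ]) ++ v ++ b ∷ c ∷ s ≡ p ++ (a ∷ v ++ b ∷ c ∷ []) ++ s
  eq = trans (++-assoc p [ a ] _) (cong (λ t → p ++ a ∷ t) (sym (++-assoc v (b ∷ c ∷ []) s)))

-- A power inside `x` is bad through its own image. A forbidden word becomes bad through its
-- neighbours, which `l` and `r` supply even at the ends of `x`.
proper-inner : ∀ n l x r → 2 ≤ length l → 2 ≤ length r → ¬ Bad (image f n (l ++ x ++ r)) → ProperW x
proper-inner n l x r ll lr nb = noPower , noForbidden
  where
  noPower : ∀ a b → IsFactorW x (pow a b) → ¬ ParikhGt a b
  noPower a b (p , s , refl) gt = nb (subst (λ t → Bad (image f n t)) (sym (infix-trans l p (pow a b) s r))
    (power-image n (l ++ p) a b (s ++ r) gt))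
  noForbidden : ∀ v → v ∈ forbidden → ¬ IsFactorW x v
  noForbidden v v∈ (p , s , refl) = nb (subst (λ t → Bad (image f n t)) (sym (infix-trans l p v s r))
    (forbidden-inner-bad n (l ++ p) (s ++ r)
      (≤-trans ll (≤-trans (m≤m+n _ _) (≤-reflexive (sym (length-++ l)))))
      (≤-trans lr (≤-trans (m≤n+m _ _) (≤-reflexive (sym (length-++ s))))) v∈))

-- Desubstitution of proper and antiproper words

nonErasing-g : NonErasing g
nonErasing-g 0F = s≤s z≤n
nonErasing-g 1F = s≤s z≤n
nonErasing-g 2F = s≤s z≤n

nonErasing-f : NonErasing f
nonErasing-f 0F = s≤s z≤n
nonErasing-f 1F = s≤s z≤n
nonErasing-f 2F = s≤s z≤n

nonErasing-h : NonErasing h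
nonErasing-h 0F = s≤s z≤n
nonErasing-h 1F = s≤s z≤n
nonErasing-h 2F = s≤s z≤n

pattern 00∈     = here refl
pattern 11∈     = there (here refl)
pattern 22∈     = there (there (here refl))
pattern 20∈     = there (there (there (here refl)))
pattern 2121∈   = there (there (there (there (there (here refl)))))

excluded : ∀ {A : Set} {v} p s → v ∈ forbidden → ProperW (p ++ v ++ s) → A
excluded p s v∈ (_ , absent) = ⊥-elim (absent _ v∈ (p , s , refl))

-- A block and the 0 after it take at most five letters. The sixth serves to refute 01212, as every
-- continuation creates 20, 2121 or 22.
f-block : ∀ a b c d e → ProperW (0F ∷ a ∷ b ∷ c ∷ d ∷ e ∷ []) →
  ∃₂ λ x s → 0F ∷ a ∷ b ∷ c ∷ d ∷ e ∷ [] ≡ f x ++ 0F ∷ s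
f-block 0F b  c  d  e  = excluded [] _ 00∈
f-block 1F 0F c  d  e  = λ _ → 2F , _ , refl
f-block 1F 1F c  d  e  = excluded [ _ ] _ 11∈
f-block 1F 2F 0F d  e  = excluded (_ ∷ _ ∷ []) _ 20∈
f-block 1F 2F 1F 0F e  = λ _ → 0F , _ , refl
f-block 1F 2F 1F 1F e  = excluded (_ ∷ _ ∷ _ ∷ []) _ 11∈
f-block 1F 2F 1F 2F 0F = excluded (_ ∷ _ ∷ _ ∷ _ ∷ []) _ 20∈
f-block 1F 2F 1F 2F 1F = excluded (_ ∷ _ ∷ []) _ 2121∈
f-block 1F 2F 1F 2F 2F = excluded (_ ∷ _ ∷ _ ∷ _ ∷ []) _ 22∈
f-block 1F 2F 2F d  e  = excluded (_ ∷ _ ∷ []) _ 22∈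
f-block 2F 0F c  d  e  = excluded [ _ ] _ 20∈
f-block 2F 1F 0F d  e  = λ _ → 1F , _ , refl
f-block 2F 1F 1F d  e  = excluded (_ ∷ _ ∷ []) _ 11∈
f-block 2F 1F 2F 0F e  = excluded (_ ∷ _ ∷ _ ∷ []) _ 20∈
f-block 2F 1F 2F 1F e  = excluded [ _ ] _ 2121∈
f-block 2F 1F 2F 2F e  = excluded (_ ∷ _ ∷ _ ∷ []) _ 22∈
f-block 2F 2F c  d  e  = excluded [ _ ] _ 22∈

-- Blocks of `h` end in 0, so cuts lie just after a 0; the leading 0 belongs to the preceding block.
-- The decomposition of `h x` locates the next cut.
h-block : ∀ a b c d → AntiproperW (0F ∷ a ∷ b ∷ c ∷ d ∷ []) →
  ∃₂ λ x t → ∃[ s ] (a ∷ b ∷ c ∷ d ∷ [] ≡ h x ++ s × h x ≡ t ++ [ 0F ])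
h-block 0F b  c  d  = excluded (_ ∷ _ ∷ _ ∷ []) [] 00∈
h-block 1F 0F c  d  = λ _ → 2F , [ 1F ] , _ , refl , refl
h-block 1F 1F c  d  = excluded (_ ∷ _ ∷ []) _ 11∈
h-block 1F 2F 0F d  = λ _ → 1F , 1F ∷ 2F ∷ [] , _ , refl , refl
h-block 1F 2F 1F 0F = λ _ → 0F , 1F ∷ 2F ∷ 1F ∷ [] , _ , refl , refl
h-block 1F 2F 1F 1F = excluded [] _ 11∈
h-block 1F 2F 1F 2F = excluded [] _ 2121∈
h-block 1F 2F 2F d  = excluded [ _ ] _ 22∈
h-block 2F b  c  d  = excluded (_ ∷ _ ∷ _ ∷ []) [] 20∈

-- Without 0, 11 and 22 the letters 1 and 2 alternate, and five alternating letters contain 2121.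
contains-0 : ∀ a b c d e → ProperW (a ∷ b ∷ c ∷ d ∷ e ∷ []) → 0F ∈ a ∷ b ∷ c ∷ d ∷ e ∷ []
contains-0 0F b  c  d  e  _ = here refl
contains-0 1F 0F c  d  e  _ = there (here refl)
contains-0 2F 0F c  d  e  _ = there (here refl)
contains-0 1F 1F c  d  e    = excluded [] _ 11∈
contains-0 2F 2F c  d  e    = excluded [] _ 22∈
contains-0 1F 2F 0F d  e    = excluded [ _ ] _ 20∈
contains-0 1F 2F 1F 0F e  _ = there (there (there (here refl)))
contains-0 1F 2F 1F 1F e    = excluded (_ ∷ _ ∷ []) _ 11∈
contains-0 1F 2F 1F 2F 0F _ = there (there (there (there (here refl))))
contains-0 1F 2F 1F 2F 1F   = excluded [ _ ] _ 2121∈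
contains-0 1F 2F 1F 2F 2F   = excluded (_ ∷ _ ∷ _ ∷ []) _ 22∈
contains-0 1F 2F 2F d  e    = excluded [ _ ] _ 22∈
contains-0 2F 1F 0F d  e  _ = there (there (here refl))
contains-0 2F 1F 1F d  e    = excluded [ _ ] _ 11∈
contains-0 2F 1F 2F 0F e    = excluded (_ ∷ _ ∷ []) _ 20∈
contains-0 2F 1F 2F 1F e    = excluded [] _ 2121∈
contains-0 2F 1F 2F 2F e    = excluded (_ ∷ _ ∷ []) _ 22∈

occ-∈ : ∀ {A : Set} (v : Inf A) i {x a} → a ∈ x → Occ v i x → ∃[ j ] v j ≡ a
occ-∈ v i (here refl) (e , _) = i , e
occ-∈ v i (there a∈)  (_ , o) = occ-∈ v (suc i) a∈ o

occ-at-end : ∀ {A : Set} (v : Inf A) i x {a} → Occ v i (x ++ [ a ]) → v (length x + i) ≡ a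
occ-at-end v i x o = proj₁ (occ-++⁻ʳ v i x o)

window : ∀ {A : Set} (v : Inf A) i n → IsFactor v (applyUpTo (λ k → v (k + i)) n)
window v i n = occ⇒factor v i _ (occ-applyUpTo v i _ (λ _ → refl) n)

proper-desubstitution : ∀ u → Proper u → ∃[ u′ ] HasFinalSegment u (morphInf f u′)
proper-desubstitution u prop = desubstitute (proj₁ start) (proj₂ start)
  where
  step : ∀ i → u i ≡ 0F → ∃[ a ] (Occ u i (f a) × u (length (f a) + i) ≡ 0F)
  step i e with f-block _ _ _ _ _ (subst
    (λ a → ProperW (a ∷ u (1 + i) ∷ u (2 + i) ∷ u (3 + i) ∷ u (4 + i) ∷ u (5 + i) ∷ [])) e
    (prop (applyUpTo (λ k → u (k + i)) 6) (window u i 6)))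
  ... | a , s , eq = a , occ-++⁻ˡ u i (f a) o , proj₁ (occ-++⁻ʳ u i (f a) o)
    where o = subst (Occ u i) eq (e , refl , refl , refl , refl , refl , tt)
  open Desubstitution f nonErasing-f u (λ i → u i ≡ 0F) step
  start : ∃[ i ] u i ≡ 0F
  start = occ-∈ u 0 (contains-0 _ _ _ _ _ (prop _ (window u 0 5))) (occ-applyUpTo u 0 _ (λ _ → refl) 5)

antiproper-desubstitution : ∀ u → Antiproper u → ∃[ u′ ] HasFinalSegment u (morphInf h u′)
antiproper-desubstitution u anti = desubstitute (suc (proj₁ start)) (proj₁ start , refl , proj₂ start)
  where
  AfterZero : ℕ → Set
  AfterZero i = ∃[ j ] (i ≡ suc j × u j ≡ 0F)
  step : ∀ i → AfterZero i → ∃[ a ] (Occ u i (h a) × AfterZero (length (h a) + i))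
  step .(suc j) (j , refl , e) with h-block _ _ _ _ (subst
    (λ a → AntiproperW (a ∷ u (1 + j) ∷ u (2 + j) ∷ u (3 + j) ∷ u (4 + j) ∷ [])) e
    (anti (applyUpTo (λ k → u (k + j)) 5) (window u j 5)))
  ... | a , t , s , eq , last = a , o , length t + suc j , position ,
    occ-at-end u (suc j) t (subst (Occ u (suc j)) last o)
    where
    o = occ-++⁻ˡ u (suc j) (h a) (subst (Occ u (suc j)) eq (refl , refl , refl , refl , tt))
    position : length (h a) + suc j ≡ suc (length t + suc j)
    position = cong (_+ suc j) (trans (cong length last) (trans (length-++ t) (+-comm (length t) 1)))
  open Desubstitution h nonErasing-h u AfterZero step
  start : ∃[ i ] u i ≡ 0F
  start = occ-∈ u 0
    (AnyP.reverse⁻ (contains-0 _ _ _ _ _ (anti _ (window u 0 5))))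
    (occ-applyUpTo u 0 _ (λ _ → refl) 5)

-- Cutting a binary word into `g`-blocks

GBlock : Word Σ₂ → Set
GBlock q = (∃₂ λ a s → q ≡ g a ++ O ∷ s) ⊎ (∃[ s ] q ≡ I ∷ s)

factors4-window : ∀ w {S} → Factors4Are w S → ∀ i → ∃[ q ] (q ∈ S × Occ w i q)
factors4-window w f4 i = _ , Equivalence.to (f4 _ refl) (window w i 4) , occ-applyUpTo w i _ (λ _ → refl) 4

-- Each block of `g` is a 0 followed by at most two 1s, so four letters from a 0 onwards show the
-- whole block and the next 0. The words in `S` that begin with 1 do not occur at a cut.
g-desubstitution : ∀ w S → All GBlock S → All (O ∈_) S → Factors4Are w S → ∃[ u ] HasFinalSegment w (morphInf g u)
g-desubstitution w S blocks zeros f4 = desubstitute (proj₁ start) (proj₂ start)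
  where
  step : ∀ i → w i ≡ O → ∃[ a ] (Occ w i (g a) × w (length (g a) + i) ≡ O)
  step i e with factors4-window w f4 i
  ... | q , q∈ , o with All.lookup blocks q∈
  ... | inj₁ (a , s , refl) = a , occ-++⁻ˡ w i (g a) o , proj₁ (occ-++⁻ʳ w i (g a) o)
  ... | inj₂ (s , refl) with trans (sym e) (proj₁ o)
  ... | ()
  open Desubstitution g nonErasing-g w (λ i → w i ≡ O) step
  start : ∃[ i ] w i ≡ O
  start with factors4-window w f4 0
  ... | q , q∈ , o = occ-∈ w 0 (All.lookup zeros q∈) o

-- Towers of desubstitutions

tower : (Σ₃ → Word Σ₃) → ℕ → Inf Σ₃ → Inf Σ₂
tower φ n u = morphInf g (iter n (morphInf φ) u)

module Tower (φ : Σ₃ → Word Σ₃) (ne : NonErasing φ) where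

  tower-occ : ∀ n u y → Occ u 0 y → Occ (tower φ n u) 0 (image φ n y)
  tower-occ n u y o = occ-morphInf g nonErasing-g (iter n (morphInf φ) u) _ (go n)
    where
    go : ∀ n → Occ (iter n (morphInf φ) u) 0 (iter n (morph φ) y)
    go zero    = o
    go (suc n) = occ-morphInf φ ne (iter n (morphInf φ) u) _ (go n)

  tower-finalSegment : ∀ n u v → HasFinalSegment u v → HasFinalSegment (tower φ n u) (tower φ n v)
  tower-finalSegment n u v fs = morphInf-finalSegment g nonErasing-g (iter n (morphInf φ) u) (iter n (morphInf φ) v) (go n)
    where
    go : ∀ n → HasFinalSegment (iter n (morphInf φ) u) (iter n (morphInf φ) v)
    go zero    = fs
    go (suc n) = morphInf-finalSegment φ ne (iter n (morphInf φ) u) (iter n (morphInf φ) v) (go n)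

  module _ (w : Inf Σ₂) (Clean : Inf Σ₃ → Set)
    (clean : ∀ n u → HasFinalSegment w (tower φ n u) → Clean (dropInf 2 u))
    (descend : ∀ u → Clean u → ∃[ u′ ] HasFinalSegment u (morphInf φ u′))
    (base : ∃[ u ] HasFinalSegment w (morphInf g u)) where

    -- Induction on the level: `descend` desubstitutes the clean word found so far, and `clean`
    -- makes the result clean again at the cost of two letters, which only shortens the final
    -- segment of `w`.
    levels : ∀ n → ∃[ u ] (Clean u × HasFinalSegment w (tower φ n u))
    levels n = let u , fs = raw n in
      dropInf 2 u , clean n u fs , finalSegment-trans w (tower φ n u) (tower φ n (dropInf 2 u)) fs (tower-finalSegment n u (dropInf 2 u) (2 , λ _ → refl))
      where
      raw : ∀ n → ∃[ u ] HasFinalSegment w (tower φ n u)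
      raw zero    = base
      raw (suc n) with levels n
      ... | u , cl , fs with descend u cl
      ... | u′ , fs′ = u′ , subst (λ z → HasFinalSegment w (morphInf g z)) (iter-comm n (morphInf φ) u′)
        (finalSegment-trans w (tower φ n u) (tower φ n (morphInf φ u′)) fs (tower-finalSegment n u (morphInf φ u′) fs′))

-- The dropped letters guarantee the left margin; on the right an infinite word always continues.
surround : ∀ {A : Set} (u : Inf A) k x → IsFactor (dropInf k u) x → ∀ m →
  ∃₂ λ l r → k ≤ length l × length r ≡ m × Occ u 0 (l ++ x ++ r)
surround u k x fx m with factor⇒occ _ x fx
... | i , o = prefix u (k + i) , r ,
  ≤-trans (m≤m+n k i) (≤-reflexive (sym (length-factorAt u 0 (k + i)))) , length-factorAt u _ m ,
  occ-++⁺ u 0 (prefix u (k + i)) (occ-factorAt u 0 (k + i))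
    (subst (λ j → Occ u j (x ++ r)) (sym (trans (+-identityʳ _) (length-factorAt u 0 (k + i))))
      (occ-++⁺ u (k + i) x (dropInf-occ u k i x o) (occ-factorAt u (length x + (k + i)) m)))
  where r = factorAt u (length x + (k + i)) m

no-bad : ∀ w → PowerFree w → Factors4Are w Fset → ∀ i z → Occ w i z → ¬ Bad z
no-bad w pf f4 i z o (power p x y s refl lt)     = pf _ x y lt (occ-infix w i p (pow x y) o)
no-bad w pf f4 i z o (alien p q s refl len q∉) = q∉ (Equivalence.to (f4 q len) (occ⇒factor w _ q (occ-infix w i p q o)))

case1 : ∀ w → PowerFree w → Factors4Are w Fset → Case1 w
case1 w pf f4 = f4 , λ n _ → levels w Proper clean proper-desubstitution base n
  where
  open Tower f nonErasing-f
  base = g-desubstitution w Fset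
    ( inj₁ (0F , _ , refl) ∷ inj₂ (_ , refl) ∷ inj₁ (1F , _ , refl) ∷ inj₂ (_ , refl)
    ∷ inj₁ (1F , _ , refl) ∷ inj₁ (2F , _ , refl) ∷ inj₂ (_ , refl) ∷ inj₂ (_ , refl) ∷ [])
    (from-yes (All.all? (λ q → Any.any? (O ≟_) q) Fset)) f4
  clean : ∀ n u → HasFinalSegment w (tower f n u) → Proper (dropInf 2 u)
  clean n u (k , fs) x fx with surround u 2 x fx 2
  ... | l , r , ll , lr , o = proper-inner n l x r ll (≤-reflexive (sym lr))
    (no-bad w pf f4 _ _ (occ-final w (tower f n u) k fs 0 _ (tower-occ n u _ o)))

-- Reversal

reverse-morph : ∀ {A B : Set} (φ ψ : A → Word B) → (∀ a → reverse (φ a) ≡ ψ a) → ∀ x → reverse (morph φ x) ≡ morph ψ (reverse x)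
reverse-morph φ ψ eq []      = refl
reverse-morph φ ψ eq (a ∷ x) = begin
  reverse (φ a ++ morph φ x)              ≡⟨ reverse-++ (φ a) (morph φ x) ⟩
  reverse (morph φ x) ++ reverse (φ a)    ≡⟨ cong₂ _++_ (reverse-morph φ ψ eq x) (trans (eq a) (sym (++-identityʳ (ψ a)))) ⟩
  morph ψ (reverse x) ++ morph ψ [ a ]    ≡⟨ morph-++ ψ (reverse x) [ a ] ⟨
  morph ψ (reverse x ++ [ a ])            ≡⟨ cong (morph ψ) (unfold-reverse a x) ⟨
  morph ψ (reverse (a ∷ x))               ∎
  where open ≡-Reasoning

reverse-h : ∀ a → reverse (h a) ≡ f a
reverse-h 0F = refl
reverse-h 1F = refl
reverse-h 2F = refl

reverse-iter-h : ∀ n x → reverse (iter n (morph h) x) ≡ iter n (morph f) (reverse x)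
reverse-iter-h zero    x = refl
reverse-iter-h (suc n) x = trans (reverse-morph h f reverse-h (iter n (morph h) x)) (cong (morph f) (reverse-iter-h n x))

gᴿ : Σ₃ → Word Σ₂
gᴿ a = reverse (g a)

-- Each `g a` is a 0 followed by 1s, so its reversal is the same block with the 0 moved to the end:
-- `g` and `gᴿ` are conjugate by the letter 0.
gᴿ-conjugate : ∀ y → O ∷ morph gᴿ y ≡ morph g y ++ [ O ]
gᴿ-conjugate []       = refl
gᴿ-conjugate (0F ∷ y) = cong (λ t → O ∷ I ∷ I ∷ t) (gᴿ-conjugate y)
gᴿ-conjugate (1F ∷ y) = cong (O ∷_) (gᴿ-conjugate y)
gᴿ-conjugate (2F ∷ y) = cong (λ t → O ∷ I ∷ t) (gᴿ-conjugate y)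

-- Reversal turns `h` into `f` exactly but `g` only into a conjugate, which the extra 0 compensates.
reverse-image-h : ∀ n x → reverse (image h n x ++ [ O ]) ≡ image f n (reverse x) ++ [ O ]
reverse-image-h n x = begin
  reverse (image h n x ++ [ O ])                  ≡⟨ reverse-++ (image h n x) [ O ] ⟩
  O ∷ reverse (morph g (iter n (morph h) x))      ≡⟨ cong (O ∷_) (reverse-morph g gᴿ (λ _ → refl) (iter n (morph h) x)) ⟩
  O ∷ morph gᴿ (reverse (iter n (morph h) x))     ≡⟨ gᴿ-conjugate (reverse (iter n (morph h) x)) ⟩
  morph g (reverse (iter n (morph h) x)) ++ [ O ] ≡⟨ cong (λ t → morph g t ++ [ O ]) (reverse-iter-h n x) ⟩
  image f n (reverse x) ++ [ O ]                  ∎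
  where open ≡-Reasoning

image-h-starts-with-O : ∀ n c → ∃[ t ] image h n [ c ] ≡ O ∷ t
image-h-starts-with-O n c = g-head (iter n (morph h) [ c ]) (nonempty n)
  where
  nonempty : ∀ n → 1 ≤ length (iter n (morph h) [ c ])
  nonempty zero    = s≤s z≤n
  nonempty (suc n) = ≤-trans (nonempty n) (length-morph h nonErasing-h (iter n (morph h) [ c ]))
  g-head : ∀ z → 1 ≤ length z → ∃[ t ] morph g z ≡ O ∷ t
  g-head (0F ∷ z) _ = _ , refl
  g-head (1F ∷ z) _ = _ , refl
  g-head (2F ∷ z) _ = _ , refl

reverse-infix : ∀ {A : Set} (p x s : List A) → reverse (p ++ x ++ s) ≡ reverse s ++ reverse x ++ reverse p
reverse-infix p x s = trans (reverse-++ p (x ++ s))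
  (trans (cong (_++ reverse p) (reverse-++ x s)) (++-assoc (reverse s) (reverse x) (reverse p)))

no-bad-reverse : ∀ w → PowerFree w → Factors4Are w (revSet Fset) → ∀ i z → Occ w i z → ¬ Bad (reverse z)
no-bad-reverse w pf f4 i z o (power p x y s eq lt) = pf _ (reverse x) (reverse y)
  (subst₂ _<_ (sym (length-reverse y)) (sym (length-reverse x)) lt)
  (subst (Occ w _) (reverse-pow x y) (occ-infix w i (reverse s) (reverse (pow x y))
    (subst (Occ w i) (trans (sym (reverse-involutive z)) (trans (cong reverse eq) (reverse-infix p (pow x y) s))) o)))
no-bad-reverse w pf f4 i z o (alien p q s eq len q∉)
  with ∈-map⁻ reverse (Equivalence.to (f4 (reverse q) (trans (length-reverse q) len))
    (occ⇒factor w _ _ (occ-infix w i (reverse s) (reverse q)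
      (subst (Occ w i) (trans (sym (reverse-involutive z)) (trans (cong reverse eq) (reverse-infix p q s))) o))))
... | q′ , q′∈ , e = q∉ (subst (_∈ Fset) (sym (reverse-injective e)) q′∈)

case3 : ∀ w → PowerFree w → Factors4Are w (revSet Fset) → Case3 w
case3 w pf f4 = f4 , λ n _ → levels w Antiproper clean antiproper-desubstitution base n
  where
  open Tower h nonErasing-h
  base = g-desubstitution w (revSet Fset)
    ( inj₁ (0F , _ , refl) ∷ inj₂ (_ , refl) ∷ inj₂ (_ , refl) ∷ inj₁ (1F , _ , refl)
    ∷ inj₁ (2F , _ , refl) ∷ inj₁ (1F , _ , refl) ∷ inj₂ (_ , refl) ∷ inj₁ (2F , _ , refl) ∷ [])
    (from-yes (All.all? (λ q → Any.any? (O ≟_) q) (revSet Fset))) f4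
  clean : ∀ n u → HasFinalSegment w (tower h n u) → Antiproper (dropInf 2 u)
  clean n u (k , fs) x fx with surround u 2 x fx 2
  -- Reversal exchanges the two margins.
  ... | l , r , ll , lr , o = proper-inner n (reverse r) (reverse x) (reverse l)
    (≤-reflexive (sym (trans (length-reverse r) lr))) (≤-trans ll (≤-reflexive (sym (length-reverse l))))
    λ bad → no-bad-reverse w pf f4 _ _ occ-O
      (subst Bad (sym (trans (reverse-image-h n y) (cong (λ t → image f n t ++ [ O ]) (reverse-infix l x r))))
        (bad-infix [] [ O ] bad))
    where
    y = l ++ x ++ r
    -- The letter of `u` right after `y`: its image begins with the 0 that `reverse-image-h` asks
    -- for.
    c = u (length y + 0)
    occ-O : Occ w (k + 0) (image h n y ++ [ O ])
    occ-O with image-h-starts-with-O n c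
    ... | t , et = occ-++⁻ˡ w (k + 0) (image h n y ++ [ O ])
      (subst (Occ w (k + 0))
        (trans (image-++ h n y [ c ]) (trans (cong (image h n y ++_) et) (sym (++-assoc (image h n y) [ O ] t))))
        (occ-final w (tower h n u) k fs 0 _ (tower-occ n u (y ++ [ c ]) (occ-++⁺ u 0 y o (refl , tt)))))

-- Complementation

comp-involutive : ∀ a → comp (comp a) ≡ a
comp-involutive 0F = refl
comp-involutive 1F = refl

compW-involutive : ∀ x → compW (compW x) ≡ x
compW-involutive []      = refl
compW-involutive (a ∷ x) = cong₂ _∷_ (comp-involutive a) (compW-involutive x)

compInf-occ : ∀ w i x → Occ (compInf w) i x → Occ w i (compW x)
compInf-occ w i []      _       = tt
compInf-occ w i (a ∷ x) (e , o) = trans (sym (comp-involutive (w i))) (cong comp e) , compInf-occ w (suc i) x o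

occ-compInf : ∀ w i x → Occ w i x → Occ (compInf w) i (compW x)
occ-compInf w i []      _       = tt
occ-compInf w i (a ∷ x) (e , o) = cong comp e , occ-compInf w (suc i) x o

compInf-powerFree : ∀ w → PowerFree w → PowerFree (compInf w)
compInf-powerFree w pf i x y lt o = pf i (compW x) (compW y)
  (subst₂ _<_ (sym (length-map comp y)) (sym (length-map comp x)) lt)
  (subst (Occ w i) (map-pow comp x y) (compInf-occ w i (pow x y) o))

compInf-factors4 : ∀ w {S} → Factors4Are w (compSet S) → Factors4Are (compInf w) S
compInf-factors4 w {S} f4 x lx = mk⇔ to from
  where
  module E = Equivalence (f4 (compW x) (trans (length-map comp x) lx))
  to : IsFactor (compInf w) x → x ∈ S
  to fx with factor⇒occ (compInf w) x fx
  ... | i , o with ∈-map⁻ compW (E.to (occ⇒factor w i _ (compInf-occ w i x o)))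
  ... | y , y∈ , e = subst (_∈ S) (trans (sym (compW-involutive y)) (trans (cong compW (sym e)) (compW-involutive x))) y∈
  from : x ∈ S → IsFactor (compInf w) x
  from x∈ with factor⇒occ w _ (E.from (∈-map⁺ compW x∈))
  ... | i , o = occ⇒factor (compInf w) i x (subst (Occ (compInf w) i) (compW-involutive x) (occ-compInf w i _ o))

compInf-final : ∀ w v → HasFinalSegment (compInf w) v → HasFinalSegment w (compInf v)
compInf-final w v (k , e) = k , λ i → trans (sym (comp-involutive (w (k + i)))) (cong comp (e i))

case2 : ∀ w → PowerFree w → Factors4Are w (compSet Fset) → Case2 w
case2 w pf f4 = f4 , λ n n≥1 →
  let u , prop , fs = proj₂ (case1 (compInf w) (compInf-powerFree w pf) (compInf-factors4 w f4)) n n≥1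
  in u , prop , compInf-final w (tower f n u) fs

case4 : ∀ w → PowerFree w → Factors4Are w (compSet (revSet Fset)) → Case4 w
case4 w pf f4 = f4 , λ n n≥1 →
  let u , anti , fs = proj₂ (case3 (compInf w) (compInf-powerFree w pf) (compInf-factors4 w f4)) n n≥1
  in u , anti , compInf-final w (tower h n u) fs

-- Mutual exclusion and assembly of the four cases

factors4-distinct : ∀ w {S S′} q → length q ≡ 4 → q ∈ S → q ∉ S′ → Factors4Are w S → Factors4Are w S′ → ⊥
factors4-distinct w q len q∈ q∉ f4 f4′ = q∉ (Equivalence.to (f4′ q len) (Equivalence.from (f4 q len) q∈))

theorem2 : (w : Inf Σ₂) → Rote w → Avoids52Plus w →
    ExactlyOne4 (Case1 w) (Case2 w) (Case3 w) (Case4 w)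
theorem2 w rote avoids =
  -- The words 0110, 1001, 0011 and 1100 lie in all four sets, so each witness is chosen among the
  -- other four words of the first set of its pair.
  one , exclude (w4 O I O O) , exclude (w4 I I O I) , exclude (w4 O O I O) ,
        exclude (w4 I I O I) , exclude (w4 O O I O) , exclude (w4 O O I O)
  where
  pf = avoids⇒powerFree w avoids
  one : Case1 w ⊎ Case2 w ⊎ Case3 w ⊎ Case4 w
  one with factors4-cases w rote pf
  ... | inj₁ f4               = inj₁ (case1 w pf f4)
  ... | inj₂ (inj₁ f4)        = inj₂ (inj₁ (case2 w pf f4))
  ... | inj₂ (inj₂ (inj₁ f4)) = inj₂ (inj₂ (inj₁ (case3 w pf f4)))
  ... | inj₂ (inj₂ (inj₂ f4)) = inj₂ (inj₂ (inj₂ (case4 w pf f4)))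
  exclude : ∀ {S S′} {P Q : Set} q {_ : True (length q ≟ℕ 4)} {_ : True (q ∈? S)} {_ : False (q ∈? S′)} →
    ¬ ((Factors4Are w S × P) × (Factors4Are w S′ × Q))
  exclude q {len} {q∈} {q∉} ((f4 , _) , (f4′ , _)) =
    factors4-distinct w q (toWitness len) (toWitness q∈) (toWitnessFalse q∉) f4 f4′
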